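{- There exists $n_0$ such that for every $n>n_0$ there is an odd-sunflower-free family $\mathcal{F}\subseteq 2^{\{1,\dots,n\}}$ with $|\mathcal{F}|>1.502148^n$. That is, $f_{odd}(n)>1.502148^n$ for all $n>n_0$, where $f_{odd}(n)$ is the maximum size of an odd-sunflower-free family of subsets of $\{1,\dots,n\}$.
   Context: A family of at least two nonempty sets is an odd-sunflower if every element of the underlying set is contained in an odd number of sets of the family, or in none. A family is odd-sunflower-free if no subfamily of it is an odd-sunflower. -}

module Defs where

open import Data.Nat using (ℕ; zero; suc; _≤_; _%_)
open import Data.Bool using (true; false)
open import Data.Fin using (Fin)
open import Data.Fin.Subset using (Subset; Nonempty)
open import Data.List using (List; []; _∷_; length)
open import Data.List.Relation.Unary.All using (All)
open import Data.List.Relation.Binary.Sublist.Propositional using (_⊆_)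
open import Data.Product using (_×_)
open import Data.Sum using (_⊎_)
open import Data.Vec using (lookup)
open import Relation.Binary.PropositionalEquality using (_≡_)
open import Relation.Nullary using (¬_)

occ : ∀ {n} → List (Subset n) → Fin n → ℕ
occ [] i = 0
occ (S ∷ G) i with lookup S i
... | true  = suc (occ G i)
... | false = occ G i

OddSunflower : ∀ {n} → List (Subset n) → Set
OddSunflower {n} G =
  (2 ≤ length G) × All Nonempty G ×
  (∀ (i : Fin n) → occ G i ≡ 0 ⊎ occ G i % 2 ≡ 1)

OddSunflowerFree : ∀ {n} → List (Subset n) → Set
OddSunflowerFree F = ∀ G → G ⊆ F → ¬ OddSunflower G

{-# OPTIONS --safe #-}

-- Call a family "good" if every list of its members (repetitions allowed) in
-- which each point is covered an odd number of times or never is constant, and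
-- "odd-good" if this holds for lists of odd length.  Odd-good families are
-- closed under products, and a point common to all members upgrades odd-good to
-- good, because it forces the length to be odd.  The triangle {12, 13, 23} is
-- good.  Take N + 1 disjoint copies of a good family, leave one copy empty and
-- choose a member in each of the others: the result is odd-good.  Indeed, in a
-- list of odd length some copy j is left empty an odd number of times, so it is
-- used an even number of times, hence never.  Eight triangles give 8 · 3⁷ sets
-- on 24 points, and (8 · 3⁷)^(1/24) = 1.50241….

module Submission where

open import Defs
open import Data.Nat using (ℕ; _<_; _*_; _^_)
open import Data.Fin.Subset using (Subset)
open import Data.List using (List; length)
open import Data.List.Relation.Unary.Unique.Propositional using (Unique)
open import Data.Product using (Σ; _×_)

open import Data.Bool using (Bool; true; false)
open import Data.Fin using (Fin; zero; suc; combine; remQuot; punchIn; punchOut; _↑ʳ_)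
open import Data.Fin.Properties using (_≟_; combine-remQuot; punchIn-punchOut)
open import Data.Fin.Subset using (⊤; ⊥; ⁅_⁆; ∁)
open import Data.List using ([]; _∷_; map; catMaybes; mapMaybe; filter; tabulate)
open import Data.List.Membership.Propositional using (_∈_; _∉_)
open import Data.List.Membership.Propositional.Properties using (∈-map⁺; ∈-tabulate⁻)
open import Data.List.Properties using (length-map; length-tabulate; map-∘; map-cong)
open import Data.List.Relation.Binary.Sublist.Propositional using (_⊆_; _∷_; _∷ʳ_) renaming ([] to []ˢ; lookup to lookupˢ)
open import Data.List.Relation.Binary.Sublist.Propositional.Properties using (All-resp-⊆)
open import Data.List.Relation.Unary.All using ([]; _∷_)
open import Data.List.Relation.Unary.AllPairs using ([]; _∷_)
open import Data.List.Relation.Unary.Any using (here; there)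
open import Data.List.Relation.Unary.Unique.Propositional.Properties using (tabulate⁺)
open import Data.Maybe using (Maybe; just; nothing; maybe)
open import Data.Nat using (zero; suc; _+_; _≤_; s≤s; _%_; _/_; NonZero; ≢-nonZero⁻¹; parity)
open import Data.Nat.DivMod using (m≡m%n+[m/n]*n; m%n<n; /-mono-≤; m*n/n≡m)
open import Data.Nat.Properties using (+-suc; +-identityʳ; *-comm; *-assoc; *-monoˡ-≤; *-mono-≤; *-monoˡ-<; *-cancelˡ-≤; *-cancelˡ-<; ^-distribˡ-+-*; ^-*-assoc; ^-monoˡ-≤; ^-monoʳ-≤; m^n≢0; m≤m+n; ≤ᵇ⇒≤; ≤-refl; ≤-reflexive; *-monoʳ-<; m<n+m; n≢0⇒n>0; module ≤-Reasoning)
open import Data.Nat.Solver using (module +-*-Solver)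
open import Data.Parity using (0ℙ; 1ℙ)
open import Data.Parity.Properties using (+-homo-+)
import Data.Parity as ℙ
open import Data.Product using (∃; _,_; proj₁; proj₂)
open import Data.Sum using (_⊎_; inj₁; inj₂)
open import Data.Vec using (Vec; []; _∷_; _++_; lookup; concat; insertAt; head; tail) renaming (map to mapᵛ)
open import Data.Vec.Properties using (lookup-map; lookup-concat; lookup-++ʳ; lookup-replicate; insertAt-lookup; insertAt-punchIn)
open import Data.Vec.Relation.Binary.Pointwise.Extensional using (ext; Pointwise-≡⇒≡)
open import Function using (_∘_)
open import Relation.Binary.PropositionalEquality using (_≡_; _≢_; refl; sym; trans; cong; cong₂; subst; module ≡-Reasoning)
open import Relation.Nullary using (yes; no; contradiction)

private
  variable
    A C : Set
    m n w : ℕ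

-- Parity of occurrence numbers

OddOrZero : ℕ → Set
OddOrZero k = k ≡ 0 ⊎ k % 2 ≡ 1

Balanced : List (Subset n) → Set
Balanced G = ∀ i → OddOrZero (occ G i)

%2⇒parity : ∀ k → k % 2 ≡ 1 → parity k ≡ 1ℙ
%2⇒parity 1             _  = refl
%2⇒parity (suc (suc k)) eq = %2⇒parity k eq

odd+even : ∀ a b → parity (a + b) ≡ 1ℙ → parity b ≡ 1ℙ → parity a ≡ 0ℙ
odd+even a b ab-odd b-odd with parity a | parity b | trans (sym (+-homo-+ a b)) ab-odd
odd+even a b _ refl | 0ℙ | 1ℙ | _ = refl
odd+even a b _ refl | 1ℙ | 1ℙ | ()

OddOrZero∧even⇒0 : ∀ {k} → OddOrZero k → parity k ≡ 0ℙ → k ≡ 0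
OddOrZero∧even⇒0 (inj₁ k≡0) _ = k≡0
OddOrZero∧even⇒0 {k} (inj₂ k-odd) k-even with trans (sym k-even) (%2⇒parity k k-odd)
... | ()

bit : Bool → ℕ
bit true  = 1
bit false = 0

occ-∷ : (S : Subset n) (G : List (Subset n)) (i : Fin n) →
        occ (S ∷ G) i ≡ bit (lookup S i) + occ G i
occ-∷ S G i with lookup S i
... | true  = refl
... | false = refl

occ-map-cong : {f : C → Subset m} {g : C → Subset n} {i : Fin m} {j : Fin n} →
               (∀ c → lookup (f c) i ≡ lookup (g c) j) →
               ∀ L → occ (map f L) i ≡ occ (map g L) j
occ-map-cong f≗g [] = refl
occ-map-cong {f = f} {g} {i} {j} f≗g (c ∷ L)
  rewrite occ-∷ (f c) (map f L) i | occ-∷ (g c) (map g L) j =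
  cong₂ (λ b k → bit b + k) (f≗g c) (occ-map-cong f≗g L)

occ≡0⇒∉ : (f : C → Subset n) {i : Fin n} (L : List C) → occ (map f L) i ≡ 0 →
          ∀ {c} → c ∈ L → lookup (f c) i ≡ false
occ≡0⇒∉ f {i} (c ∷ L) eq c∈ with lookup (f c) i in fc
occ≡0⇒∉ f (c ∷ L) eq (here refl) | false = fc
occ≡0⇒∉ f (c ∷ L) eq (there c∈)  | false = occ≡0⇒∉ f L eq c∈

occ≡length : (f : C → Subset n) {i : Fin n} (L : List C) →
             (∀ {c} → c ∈ L → lookup (f c) i ≡ true) → occ (map f L) i ≡ length L
occ≡length f [] all = refl
occ≡length f {i} (c ∷ L) all rewrite occ-∷ (f c) (map f L) i | all (here refl) =
  cong suc (occ≡length f L (all ∘ there))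

-- Good families, indexed by codes

Constant : List C → Set
Constant L = ∀ {x y} → x ∈ L → y ∈ L → x ≡ y

length≡0⇒∉ : {L : List C} → length L ≡ 0 → ∀ {x} → x ∉ L
length≡0⇒∉ {L = []} _ ()

Good : (C → Subset n) → Set
Good f = ∀ L → Balanced (map f L) → OddOrZero (length L) × Constant L

OddGood : (C → Subset n) → Set
OddGood f = ∀ L → parity (length L) ≡ 1ℙ → Balanced (map f L) → Constant L

Injective : {B : Set} → (A → B) → Set
Injective f = ∀ {x y} → f x ≡ f y → x ≡ y

triple-Balanced : (S : Subset n) → Balanced (S ∷ S ∷ S ∷ [])
triple-Balanced S i rewrite occ-∷ S (S ∷ S ∷ []) i | occ-∷ S (S ∷ []) i | occ-∷ S [] i
  with lookup S i
... | true  = inj₂ refl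
... | false = inj₁ refl

-- If `f x` and `f y` are the same set, the list `x, y, y` covers each point three times or never,
-- so it is constant.
Good⇒Injective : {f : C → Subset n} → Good f → Injective f
Good⇒Injective {f = f} good {x} {y} fx≡fy =
  proj₂ (good (x ∷ y ∷ y ∷ [])
              (subst (λ S → Balanced (S ∷ f y ∷ f y ∷ [])) (sym fx≡fy) (triple-Balanced (f y))))
        (here refl) (there (here refl))

OddGood-∘ : {f : C → Subset n} {h : A → C} → Injective h → OddGood f → OddGood (f ∘ h)
OddGood-∘ {f = f} {h} inj good L odd balanced x∈ y∈ =
  inj (good (map h L) (trans (cong parity (length-map h L)) odd)
            (subst Balanced (map-∘ L) balanced)
            (∈-map⁺ h x∈) (∈-map⁺ h y∈))

-- Products of blocks and common points

Balanced-block : (v : C → Vec (Subset w) n) (L : List C) →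
                 Balanced (map (concat ∘ v) L) →
                 ∀ s → Balanced (map (λ c → lookup (v c) s) L)
Balanced-block v L balanced s t =
  subst OddOrZero (occ-map-cong (λ c → lookup-concat (v c) s t) L) (balanced (combine s t))

power : (C → Subset w) → ∀ {k} → Vec C k → Subset (k * w)
power f v = concat (mapᵛ f v)

lookup-ext : {u v : Vec A n} → (∀ s → lookup u s ≡ lookup v s) → u ≡ v
lookup-ext h = Pointwise-≡⇒≡ (ext h)

-- Projecting to a coordinate keeps the length of the list, so odd length passes to every factor,
-- and constancy in each coordinate gives constancy.
power-OddGood : {f : C → Subset w} → OddGood f → ∀ {k} → OddGood (power f {k})
power-OddGood {f = f} good L odd balanced x∈ y∈ = lookup-ext λ s →
  good (map (λ v → lookup v s) L)
       (trans (cong parity (length-map _ L)) odd)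
       (subst Balanced
         (trans (map-cong (λ v → lookup-map s f v) L) (map-∘ L))
         (Balanced-block (mapᵛ f) L balanced s))
       (∈-map⁺ _ x∈) (∈-map⁺ _ y∈)

-- There is at least one common point; their variable number pads the ground set to any required
-- size.
cone : (r : ℕ) → (C → Subset w) → C → Subset (suc r + w)
cone r f c = ⊤ {suc r} ++ f c

cone-Good : (r : ℕ) {f : C → Subset w} → OddGood f → Good (cone r f)
cone-Good r {f} good L balanced = oddLength , constant
  where
  oddLength : OddOrZero (length L)
  oddLength = subst OddOrZero (occ≡length (cone r f) L (λ _ → refl)) (balanced zero)

  base : Balanced (map f L)
  base i = subst OddOrZero (occ-map-cong (λ c → lookup-++ʳ (⊤ {suc r}) (f c) i) L)
                 (balanced (suc r ↑ʳ i))

  constant : Constant L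
  constant x∈ with oddLength
  ... | inj₁ len≡0 = contradiction x∈ (length≡0⇒∉ len≡0)
  ... | inj₂ odd   = good L (%2⇒parity (length L) odd) base x∈

-- The triangle

triangle : Fin 3 → Subset 3
triangle i = ∁ ⁅ i ⁆

triangle-∌⇒≡ : ∀ i x → lookup (triangle x) i ≡ false → x ≡ i
triangle-∌⇒≡ zero             zero             _ = refl
triangle-∌⇒≡ (suc zero)       (suc zero)       _ = refl
triangle-∌⇒≡ (suc (suc zero)) (suc (suc zero)) _ = refl

triangle-∋ : ∀ i → ∃ λ j → lookup (triangle i) j ≡ true
triangle-∋ zero             = suc zero , refl
triangle-∋ (suc zero)       = zero , refl
triangle-∋ (suc (suc zero)) = zero , refl

-- Counts incidences: every member has exactly two points.
triangle-double-count : ∀ L → let o = occ (map triangle L) in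
  o zero + o (suc zero) + o (suc (suc zero)) ≡ length L + length L
triangle-double-count [] = refl
triangle-double-count (x ∷ L) = begin
  occ (map triangle (x ∷ L)) zero + occ (map triangle (x ∷ L)) (suc zero) + occ (map triangle (x ∷ L)) (suc (suc zero))
    ≡⟨ two-new x ⟩
  2 + (o zero + o (suc zero) + o (suc (suc zero)))
    ≡⟨ cong (2 +_) (triangle-double-count L) ⟩
  2 + (length L + length L)
    ≡⟨ cong suc (+-suc (length L) (length L)) ⟨
  suc (length L) + suc (length L) ∎
  where
  open ≡-Reasoning
  open +-*-Solver

  o : Fin 3 → ℕ
  o = occ (map triangle L)

  two-new : ∀ x → let o′ = occ (map triangle (x ∷ L)) in
    o′ zero + o′ (suc zero) + o′ (suc (suc zero)) ≡ 2 + (o zero + o (suc zero) + o (suc (suc zero)))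
  two-new zero = solve 3 (λ a b c → a :+ (con 1 :+ b) :+ (con 1 :+ c) := con 2 :+ (a :+ b :+ c))
    refl (o zero) (o (suc zero)) (o (suc (suc zero)))
  two-new (suc zero) = solve 3 (λ a b c → con 1 :+ a :+ b :+ (con 1 :+ c) := con 2 :+ (a :+ b :+ c))
    refl (o zero) (o (suc zero)) (o (suc (suc zero)))
  two-new (suc (suc zero)) = solve 3 (λ a b c → con 1 :+ a :+ (con 1 :+ b) :+ c := con 2 :+ (a :+ b :+ c))
    refl (o zero) (o (suc zero)) (o (suc (suc zero)))

three-odd : ∀ a b c l → a % 2 ≡ 1 → b % 2 ≡ 1 → c % 2 ≡ 1 → a + b + c ≢ l + l
three-odd a b c l a-odd b-odd c-odd eq with trans (sym lhs) (trans (cong parity eq) rhs)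
  where
  lhs : parity (a + b + c) ≡ 1ℙ
  lhs rewrite +-homo-+ (a + b) c | +-homo-+ a b
            | %2⇒parity a a-odd | %2⇒parity b b-odd | %2⇒parity c c-odd = refl

  rhs : parity (l + l) ≡ 0ℙ
  rhs rewrite +-homo-+ l l with parity l
  ... | 0ℙ = refl
  ... | 1ℙ = refl
... | ()

-- Only the member omitting `i` avoids the point `i`, so the list repeats that member. Any point `j`
-- of it is then covered `length L` times, which settles the length.
triangle-uncovered : ∀ L → Balanced (map triangle L) → ∀ i → occ (map triangle L) i ≡ 0 →
                     OddOrZero (length L) × Constant L
triangle-uncovered L balanced i i∉ with triangle-∋ i
... | j , j∈i =
  subst OddOrZero (occ≡length triangle L λ x∈ → subst (λ x → lookup (triangle x) j ≡ true) (sym (all≡i x∈)) j∈i)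
        (balanced j) ,
  λ x∈ y∈ → trans (all≡i x∈) (sym (all≡i y∈))
  where
  all≡i : ∀ {x} → x ∈ L → x ≡ i
  all≡i {x} x∈ = triangle-∌⇒≡ i x (occ≡0⇒∉ triangle L i∉ x∈)

triangle-Good : Good triangle
triangle-Good L balanced
  with balanced zero | balanced (suc zero) | balanced (suc (suc zero))
... | inj₁ z | _      | _      = triangle-uncovered L balanced zero z
... | inj₂ _ | inj₁ z | _      = triangle-uncovered L balanced (suc zero) z
... | inj₂ _ | inj₂ _ | inj₁ z = triangle-uncovered L balanced (suc (suc zero)) z
-- All three points covered an odd number of times: the number of incidences would be odd, yet it is
-- twice the length.
... | inj₂ a | inj₂ b | inj₂ c =
  contradiction (triangle-double-count L)
    (three-odd (o zero) (o (suc zero)) (o (suc (suc zero))) (length L) a b c)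
  where
  o : Fin 3 → ℕ
  o = occ (map triangle L)

-- One empty block

multiplicity : Fin n → List (Fin n) → ℕ
multiplicity j xs = length (filter (_≟ j) xs)

preds : List (Fin (suc n)) → List (Fin n)
preds []           = []
preds (zero  ∷ xs) = preds xs
preds (suc i ∷ xs) = i ∷ preds xs

length-preds : (xs : List (Fin (suc n))) → length xs ≡ length (preds xs) + multiplicity zero xs
length-preds []           = refl
length-preds (zero  ∷ xs) = trans (cong suc (length-preds xs)) (sym (+-suc _ _))
length-preds (suc i ∷ xs) = cong suc (length-preds xs)

multiplicity-preds : ∀ j (xs : List (Fin (suc n))) →
                     multiplicity (suc j) xs ≡ multiplicity j (preds xs)
multiplicity-preds j []           = refl
multiplicity-preds j (zero  ∷ xs) = multiplicity-preds j xs
multiplicity-preds j (suc i ∷ xs) with i ≟ j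
... | yes _ = cong suc (multiplicity-preds j xs)
... | no  _ = multiplicity-preds j xs

-- The multiplicities sum to the length, so one of them is odd. By induction on `n`: if zero occurs
-- an even number of times, the other entries are odd in number, and `preds` moves them to `Fin n`.
odd-multiplicity : ∀ {n} (xs : List (Fin n)) → parity (length xs) ≡ 1ℙ →
                   ∃ λ j → parity (multiplicity j xs) ≡ 1ℙ
odd-multiplicity {zero} [] ()
odd-multiplicity {suc n} xs odd with parity (multiplicity zero xs) in eq
... | 1ℙ = zero , eq
... | 0ℙ with odd-multiplicity (preds xs) preds-odd
  where
  preds-odd : parity (length (preds xs)) ≡ 1ℙ
  preds-odd with parity (length (preds xs)) | +-homo-+ (length (preds xs)) (multiplicity zero xs)
  ... | 1ℙ | _ = refl
  -- Here the whole length would be even; the chain of equations proves the absurd goal `0ℙ ≡ 1ℙ`.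
  ... | 0ℙ | h = trans (sym (trans h (cong (0ℙ ℙ.+_) eq))) (trans (cong parity (sym (length-preds xs))) odd)
...   | j , j-odd = suc j , trans (cong parity (multiplicity-preds j xs)) j-odd

-- A code is the position of the empty block together with the choices in the other blocks, in
-- order.
word : Fin (suc n) × Vec C n → Vec (Maybe C) (suc n)
word (i , v) = insertAt (mapᵛ just v) i nothing

word-hole : (c : Fin (suc n) × Vec C n) → lookup (word c) (proj₁ c) ≡ nothing
word-hole (i , v) = insertAt-lookup _ i nothing

word-punchIn : (c : Fin (suc n) × Vec C n) → ∀ s →
               lookup (word c) (punchIn (proj₁ c) s) ≡ just (lookup (proj₂ c) s)
word-punchIn (i , v) s = trans (insertAt-punchIn _ i nothing s) (lookup-map s just v)

word-used : (c : Fin (suc n) × Vec C n) {j : Fin (suc n)} → proj₁ c ≢ j →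
            ∃ λ x → lookup (word c) j ≡ just x
word-used c i≢j = lookup (proj₂ c) (punchOut i≢j) ,
  trans (cong (lookup (word c)) (sym (punchIn-punchOut i≢j))) (word-punchIn c (punchOut i≢j))

block : (C → Subset w) → Maybe C → Subset w
block f = maybe f ⊥

holed : ∀ N → (C → Subset w) → Fin (suc N) × Vec C N → Subset (suc N * w)
holed N f c = concat (mapᵛ (block f) (word c))

occ-catMaybes : (f : C → Subset w) (xs : List (Maybe C)) (t : Fin w) →
                occ (map (block f) xs) t ≡ occ (map f (catMaybes xs)) t
occ-catMaybes f []            t = refl
occ-catMaybes f (nothing ∷ xs) t
  rewrite occ-∷ ⊥ (map (block f) xs) t | lookup-replicate t false = occ-catMaybes f xs t
occ-catMaybes f (just x ∷ xs) t
  rewrite occ-∷ (f x) (map (block f) xs) t | occ-∷ (f x) (map f (catMaybes xs)) t =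
  cong (bit (lookup (f x) t) +_) (occ-catMaybes f xs t)

∈-mapMaybe : (h : A → Maybe C) (L : List A) → ∀ {a c} → a ∈ L → h a ≡ just c → c ∈ mapMaybe h L
∈-mapMaybe h (a ∷ L) (here refl) eq rewrite eq = here refl
∈-mapMaybe h (a ∷ L) (there a∈) eq with h a
... | just _  = there (∈-mapMaybe h L a∈ eq)
... | nothing = ∈-mapMaybe h L a∈ eq

-- Every code either makes a choice in block `j` or has its hole there.
length-mapMaybe-word : ∀ j (L : List (Fin (suc n) × Vec C n)) →
  length (mapMaybe (λ c → lookup (word c) j) L) + multiplicity j (map proj₁ L) ≡ length L
length-mapMaybe-word j [] = refl
length-mapMaybe-word j (c ∷ L) with proj₁ c ≟ j
... | yes refl rewrite word-hole c = trans (+-suc _ _) (cong suc (length-mapMaybe-word j L))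
... | no i≢j rewrite proj₂ (word-used c i≢j) = cong suc (length-mapMaybe-word j L)

holed-OddGood : ∀ N {f : C → Subset w} → Good f → OddGood (holed N f)
holed-OddGood {C = C} N {f} good L odd balanced = constant
  where
  used : Fin (suc N) → List C
  used j = mapMaybe (λ c → lookup (word c) j) L

  used-Balanced : ∀ j → Balanced (map f (used j))
  used-Balanced j t = subst OddOrZero (occ-catMaybes f (map (λ c → lookup (word c) j) L) t)
    (subst (λ G → OddOrZero (occ G t))
      (trans (map-cong (λ c → lookup-map j (block f) (word c)) L) (map-∘ L))
      (Balanced-block (λ c → mapᵛ (block f) (word c)) L balanced j t))

  hole : ∃ λ j → parity (multiplicity j (map proj₁ L)) ≡ 1ℙ
  hole = odd-multiplicity (map proj₁ L) (trans (cong parity (length-map proj₁ L)) odd)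

  j : Fin (suc N)
  j = proj₁ hole

  unused : length (used j) ≡ 0
  unused = OddOrZero∧even⇒0 (proj₁ (good (used j) (used-Balanced j)))
    (odd+even (length (used j)) (multiplicity j (map proj₁ L)) (trans (cong parity (length-mapMaybe-word j L)) odd) (proj₂ hole))

  hole≡j : ∀ {c} → c ∈ L → proj₁ c ≡ j
  hole≡j {c} c∈ with proj₁ c ≟ j
  ... | yes eq = eq
  ... | no i≢j = contradiction (∈-mapMaybe _ L c∈ (proj₂ (word-used c i≢j))) (length≡0⇒∉ unused)

  constant : Constant L
  constant {i , u} {i′ , v} x∈ y∈ with hole≡j x∈ | hole≡j y∈
  -- With the hole fixed at `j`, the other blocks are the `punchIn j s`, and goodness of `f` makes
  -- the choices in each of them agree.
  ... | refl | refl = cong (j ,_) (lookup-ext λ s →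
    proj₂ (good (used (punchIn j s)) (used-Balanced (punchIn j s)))
      (∈-mapMaybe _ L x∈ (word-punchIn (j , u) s))
      (∈-mapMaybe _ L y∈ (word-punchIn (j , v) s)))

-- Enumeration of codes

remQuot-injective : ∀ {a} b → Injective (remQuot {a} b)
remQuot-injective {a} b {x} {y} eq =
  trans (sym (combine-remQuot {a} b x))
        (trans (cong (λ p → combine (proj₁ p) (proj₂ p)) eq) (combine-remQuot {a} b y))

-- Base-`q` expansion, most significant digit first. Indexing by `Fin` lets a family be tabulated
-- and its size read off.
digits : ∀ {q} k → Fin (q ^ k) → Vec (Fin q) k
digits zero          _ = []
digits {q} (suc k) x = proj₁ (remQuot (q ^ k) x) ∷ digits k (proj₂ (remQuot {q} (q ^ k) x))

digits-injective : ∀ {q} k → Injective (digits {q} k)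
digits-injective zero {zero} {zero} _ = refl
digits-injective {q} (suc k) eq = remQuot-injective (q ^ k)
  (cong₂ _,_ (cong head eq) (digits-injective k (cong tail eq)))

holedCode : ∀ {q} N → Fin (suc N * q ^ N) → Fin (suc N) × Vec (Fin q) N
holedCode {q} N x = proj₁ (remQuot {suc N} (q ^ N) x) , digits N (proj₂ (remQuot {suc N} (q ^ N) x))

holedCode-injective : ∀ {q} N → Injective (holedCode {q} N)
holedCode-injective {q} N eq = remQuot-injective (q ^ N)
  (cong₂ _,_ (cong proj₁ eq) (digits-injective N (cong proj₂ eq)))

-- From good families to odd-sunflower-free families

Unique-resp-⊆ : {xs ys : List A} → xs ⊆ ys → Unique ys → Unique xs
Unique-resp-⊆ []ˢ         []       = []
Unique-resp-⊆ (_ ∷ʳ τ)    (_ ∷ u)  = Unique-resp-⊆ τ u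
Unique-resp-⊆ (refl ∷ τ)  (a ∷ u)  = All-resp-⊆ τ a ∷ Unique-resp-⊆ τ u

codes : (f : C → A) (G : List A) → (∀ {S} → S ∈ G → ∃ λ c → S ≡ f c) → ∃ λ L → G ≡ map f L
codes f []      h = [] , refl
codes f (S ∷ G) h with h (here refl) | codes f G (h ∘ there)
... | c , refl | L , refl = c ∷ L , refl

-- A subfamily inherits distinctness of its members, whereas goodness makes its list of codes
-- constant; two members contradict this.
Good⇒Free : ∀ {s} {f : Fin s → Subset n} → Good f → OddSunflowerFree (tabulate f)
Good⇒Free {f = f} good G G⊆F (2≤ , _ , balanced)
  with codes f G (∈-tabulate⁻ ∘ lookupˢ G⊆F) | Unique-resp-⊆ G⊆F (tabulate⁺ (Good⇒Injective good))
... | [] , refl | _ = contradiction 2≤ λ ()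
... | _ ∷ [] , refl | _ = contradiction 2≤ λ { (s≤s ()) }
... | L@(x ∷ y ∷ _) , refl | (fx≢fy ∷ _) ∷ _ =
  fx≢fy (cong f (proj₂ (good L balanced) (here refl) (there (here refl))))

-- Exponential growth

-- Bernoulli's inequality without fractions: if `b / a` is at least 1 + 1/c, then its `k`-th power
-- is at least 1 + k/c.
bernoulli : ∀ c .{{_ : NonZero c}} a b → suc c * a ≤ c * b → ∀ k → (c + k) * a ^ k ≤ c * b ^ k
bernoulli c a b h zero = *-monoˡ-≤ 1 (≤-reflexive (+-identityʳ c))
bernoulli c a b h (suc k) = *-cancelˡ-≤ c (begin
  c * ((c + suc k) * (a * a ^ k))
    ≤⟨ m≤m+n _ (k * (a * a ^ k)) ⟩
  -- The added term completes a product: c(c + 1 + k) + k = (c + 1)(c + k).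
  c * ((c + suc k) * (a * a ^ k)) + k * (a * a ^ k)
    ≡⟨ solve 4 (λ c k a p → c :* ((c :+ (con 1 :+ k)) :* (a :* p)) :+ k :* (a :* p)
                 := ((con 1 :+ c) :* a) :* ((c :+ k) :* p)) refl c k a (a ^ k) ⟩
  (suc c * a) * ((c + k) * a ^ k)
    ≤⟨ *-mono-≤ h (bernoulli c a b h k) ⟩
  (c * b) * (c * b ^ k)
    ≡⟨ solve 3 (λ c b p → (c :* b) :* (c :* p) := c :* (c :* (b :* p))) refl c b (b ^ k) ⟩
  c * (c * (b * b ^ k)) ∎)
  where
  open ≤-Reasoning
  open +-*-Solver

*-^-distrib : ∀ a b k → (a * b) ^ k ≡ a ^ k * b ^ k
*-^-distrib a b zero = refl
*-^-distrib a b (suc k) rewrite *-^-distrib a b k =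
  solve 4 (λ a b p q → (a :* b) :* (p :* q) := (a :* p) :* (b :* q)) refl a b (a ^ k) (b ^ k)
  where open +-*-Solver

^-remainder : ∀ x r k d → x ^ (r + k * d) ≡ x ^ r * (x ^ d) ^ k
^-remainder x r k d = trans (^-distribˡ-+-* x r (k * d))
  (cong (x ^ r *_) (trans (cong (x ^_) (*-comm k d)) (sym (^-*-assoc x d k))))

-- Each block of `d` points gains a factor 1 + 1/c over `(x / y) ^ d`. By Bernoulli, `k` blocks gain
-- more than k/c, hence more than `2 ^ d`, which pays for the `r` remaining points at a factor of at
-- most 2 each.
power-growth : ∀ x y g d c .{{_ : NonZero x}} .{{_ : NonZero y}} .{{_ : NonZero c}} →
               x ≤ 2 * y → suc c * x ^ d ≤ c * (g * y ^ d) →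
               ∀ r k → r ≤ d → c * 2 ^ d ≤ k →
               x ^ (r + k * d) < g ^ k * y ^ (r + k * d)
power-growth x y g d c x≤2y gap r k r≤d k-large = begin-strict
  x ^ (r + k * d)                   ≡⟨ ^-remainder x r k d ⟩
  x ^ r * (x ^ d) ^ k               ≤⟨ *-monoˡ-≤ _ (^-monoˡ-≤ r x≤2y) ⟩
  (2 * y) ^ r * (x ^ d) ^ k         ≡⟨ cong (_* (x ^ d) ^ k) (*-^-distrib 2 y r) ⟩
  (2 ^ r * y ^ r) * (x ^ d) ^ k     ≤⟨ *-monoˡ-≤ _ (*-monoˡ-≤ _ (^-monoʳ-≤ 2 r≤d)) ⟩
  (2 ^ d * y ^ r) * (x ^ d) ^ k     ≡⟨ solve 3 (λ a b p → (a :* b) :* p := b :* (a :* p)) refl (2 ^ d) (y ^ r) ((x ^ d) ^ k) ⟩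
  y ^ r * (2 ^ d * (x ^ d) ^ k)     <⟨ *-monoʳ-< (y ^ r) {{m^n≢0 y r}} main ⟩
  y ^ r * (g * y ^ d) ^ k           ≡⟨ cong (y ^ r *_) (*-^-distrib g (y ^ d) k) ⟩
  y ^ r * (g ^ k * (y ^ d) ^ k)     ≡⟨ solve 3 (λ a b p → b :* (a :* p) := a :* (b :* p)) refl (g ^ k) (y ^ r) ((y ^ d) ^ k) ⟩
  g ^ k * (y ^ r * (y ^ d) ^ k)     ≡⟨ cong (g ^ k *_) (^-remainder y r k d) ⟨
  g ^ k * y ^ (r + k * d)           ∎
  where
  open ≤-Reasoning
  open +-*-Solver

  main : 2 ^ d * (x ^ d) ^ k < (g * y ^ d) ^ k
  main = *-cancelˡ-< c _ _ (begin-strict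
    c * (2 ^ d * (x ^ d) ^ k)  ≡⟨ *-assoc c (2 ^ d) _ ⟨
    (c * 2 ^ d) * (x ^ d) ^ k  ≤⟨ *-monoˡ-≤ _ k-large ⟩
    k * (x ^ d) ^ k            <⟨ *-monoˡ-< ((x ^ d) ^ k) {{m^n≢0 (x ^ d) k {{m^n≢0 x d}}}} (m<n+m k (n≢0⇒n>0 (≢-nonZero⁻¹ c))) ⟩
    (c + k) * (x ^ d) ^ k      ≤⟨ bernoulli c _ _ gap k ⟩
    c * (g * y ^ d) ^ k        ∎)

-- Eight blocks are optimal: with M triangles the rate is the 3M-th root of M · 3^(M-1), whose real
-- maximum is at M = 3e, about 8.15.
blocks-OddGood : OddGood (holed 7 triangle ∘ holedCode 7)
blocks-OddGood = OddGood-∘ (holedCode-injective 7) (holed-OddGood 7 triangle-Good)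

-- The ground set consists of `suc r` common points and `k` groups of 24 points, each carrying the
-- eight-triangle family. Only the groups contribute to the size.
largeFree : ∀ x y c .{{_ : NonZero x}} .{{_ : NonZero y}} .{{_ : NonZero c}} →
  x ≤ 2 * y → suc c * x ^ 24 ≤ c * (8 * 3 ^ 7 * y ^ 24) →
  ∀ r k → suc r ≤ 24 → c * 2 ^ 24 ≤ k →
  Σ (List (Subset (suc r + k * 24))) λ F →
    Unique F × OddSunflowerFree F × x ^ (suc r + k * 24) < length F * y ^ (suc r + k * 24)
largeFree x y c x≤2y gap r k r<24 k-large =
  tabulate family , tabulate⁺ (Good⇒Injective good) , Good⇒Free good , large
  where
  family : Fin ((8 * 3 ^ 7) ^ k) → Subset (suc r + k * 24)
  family = cone r (power (holed 7 triangle ∘ holedCode 7) ∘ digits k)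

  good : Good family
  good = cone-Good r (OddGood-∘ (digits-injective k) (power-OddGood blocks-OddGood))

  large : x ^ (suc r + k * 24) < length (tabulate family) * y ^ (suc r + k * 24)
  large rewrite length-tabulate family = power-growth x y (8 * 3 ^ 7) 24 c x≤2y gap (suc r) k r<24 k-large

-- 240 works because 8 · 3⁷ / 1.502148²⁴ ≥ 241 / 240.
theorem2 : Σ ℕ (λ n₀ → (n : ℕ) → n₀ < n →
    Σ (List (Subset n)) (λ F →
    Unique F × OddSunflowerFree F ×
    (1502148 ^ n < length F * (1000000 ^ n))))
theorem2 = 240 * 2 ^ 24 * 24 , λ where
  (suc n) (s≤s n₀≤n) →
    subst (λ n → Σ (List (Subset n)) (λ F → Unique F × OddSunflowerFree F × (1502148 ^ n < length F * (1000000 ^ n))))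
      -- The predecessor is divided by 24, so that between 1 and 24 points are left over and a
      -- common point always exists.
      (cong suc (sym (m≡m%n+[m/n]*n n 24)))
      (largeFree 1502148 1000000 240 (≤ᵇ⇒≤ _ _ _) (≤ᵇ⇒≤ _ _ _) (n % 24) (n / 24)
        (m%n<n n 24)
        -- The factor 24 in the threshold guarantees `240 * 2 ^ 24` groups, as the growth estimate
        -- demands.
        (subst (_≤ n / 24) (m*n/n≡m (240 * 2 ^ 24) 24) (/-mono-≤ {o = 24} n₀≤n (≤-refl))))
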